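{- For any (fixed) integer $\ell\geq 0$, enumerating all maximal independent sets of a given graph can be done in polynomial time for graphs in the class of $(1,\ell)$-graphs.
   Context: Graphs are finite, simple and undirected. For integers $k,\ell\ge 0$, a $(k,\ell)$-graph is a graph whose vertex set can be partitioned into $k$ independent sets and $\ell$ cliques, where parts are allowed to be empty (and a single vertex may be counted either as an independent set or as a clique); such a partition is a $(k,\ell)$-partition. A maximal independent set is an independent set not properly contained in another independent set. The input is the graph alone; no $(1,\ell)$-partition is given. -}

module Defs where

open import Data.Bool.Base using (Bool; true; false; T)
open import Data.Fin.Base using (Fin)
open import Data.Fin.Subset using (Subset; _∈_; _⊂_)
open import Data.List.Base using (List; foldr; map; tabulate)
import Data.List.Membership.Propositional as List
open import Data.List.Relation.Unary.Unique.Propositional using (Unique)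
open import Data.Nat.Base using (ℕ; suc; _+_; _*_; _^_; _≤_)
open import Data.Product.Base using (Σ; ∃-syntax; _×_)
open import Data.Sum.Base using (_⊎_; inj₁; inj₂)
open import Data.Vec.Base as Vec using (Vec; []; _∷_; lookup)
open import Function.Bundles using (_⇔_)
open import Level using (0ℓ)
open import Relation.Binary.PropositionalEquality using (_≡_; _≢_)
open import Relation.Nullary using (¬_)
open import Relation.Unary using (Pred)

------------------------------------------------------------------------
-- Graphs

record Graph (n : ℕ) : Set where
  field
    edge     : Fin n → Fin n → Bool
    symm     : ∀ u v → edge u v ≡ edge v u
    loopless : ∀ v → edge v v ≡ false

  Adjacent : Fin n → Fin n → Set
  Adjacent u v = T (edge u v)

open Graph public using (Adjacent)

module _ {n : ℕ} (G : Graph n) where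

  IsIndependent : Pred (Fin n) 0ℓ → Set
  IsIndependent P = ∀ {u v} → P u → P v → ¬ Adjacent G u v

  IsClique : Pred (Fin n) 0ℓ → Set
  IsClique P = ∀ {u v} → P u → P v → u ≢ v → Adjacent G u v

  -- The partition is given by the function sending each vertex to its part;
  -- it need not be surjective, so parts may be empty.
  record KLPartition (k ℓ : ℕ) : Set where
    field
      part        : Fin n → Fin k ⊎ Fin ℓ
      independent : ∀ i → IsIndependent (λ v → part v ≡ inj₁ i)
      clique      : ∀ j → IsClique (λ v → part v ≡ inj₂ j)

  IsMaximalIndependent : Subset n → Set
  IsMaximalIndependent S =
    IsIndependent (_∈ S) × (∀ S′ → IsIndependent (_∈ S′) → ¬ (S ⊂ S′))

  EnumeratesMaximalIndependentSets : List (Subset n) → Set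
  EnumeratesMaximalIndependentSets Ss =
    Unique Ss × (∀ S → (S List.∈ Ss) ⇔ IsMaximalIndependent S)

------------------------------------------------------------------------
-- Model of computation: first-order recursive programs over binary trees
-- (pure LISP; the language F of Jones, "Computability and Complexity",
-- with several functions of several arguments), evaluated call-by-value.

infixr 5 _∙_

data Tree : Set where
  nil : Tree
  _∙_ : Tree → Tree → Tree

head tail : Tree → Tree
head nil     = nil
head (a ∙ _) = a
tail nil     = nil
tail (_ ∙ b) = b

size : Tree → ℕ
size nil     = 1
size (a ∙ b) = suc (size a + size b)

-- Expressions with m variables over f function symbols of the given arities.
data Exp {f : ℕ} (arity : Fin f → ℕ) (m : ℕ) : Set where
  var           : Fin m → Exp arity m
  `nil          : Exp arity m
  `cons         : (d e : Exp arity m) → Exp arity m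
  `head `tail   : (e : Exp arity m) → Exp arity m
  if_then_else_ : (e e₁ e₂ : Exp arity m) → Exp arity m
  call          : (g : Fin f) → Vec (Exp arity m) (arity g) → Exp arity m

record Program : Set where
  field
    {functions} : ℕ
    arity       : Fin functions → ℕ
    body        : (g : Fin functions) → Exp arity (arity g)
    main        : Exp arity 1

-- `ρ ⊢ e ⇓ v [ t ]`: in environment ρ, e evaluates to v in exactly t steps,
-- one per node of the evaluation tree.  In particular a conditional is charged
-- only for the branch taken, and a call for its arguments and its body.  Unit
-- cost is the standard time measure for this language: trees are immutable and
-- passed by reference, so each step is a bounded number of pointer operations.
-- The conditional treats nil as false and every other tree as true.
module Semantics {f : ℕ} (arity : Fin f → ℕ)
                 (body : (g : Fin f) → Exp arity (arity g)) where

  infix 4 _⊢_⇓_[_] _⊢_⇓*_[_]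

  mutual

    data _⊢_⇓_[_] {m : ℕ} (ρ : Vec Tree m) : Exp arity m → Tree → ℕ → Set where
      ⇓var  : ∀ {x} → ρ ⊢ var x ⇓ lookup ρ x [ 1 ]
      ⇓nil  : ρ ⊢ `nil ⇓ nil [ 1 ]
      ⇓cons : ∀ {d e a b s t} →
              ρ ⊢ d ⇓ a [ s ] → ρ ⊢ e ⇓ b [ t ] →
              ρ ⊢ `cons d e ⇓ a ∙ b [ suc (s + t) ]
      ⇓head : ∀ {e v t} → ρ ⊢ e ⇓ v [ t ] → ρ ⊢ `head e ⇓ head v [ suc t ]
      ⇓tail : ∀ {e v t} → ρ ⊢ e ⇓ v [ t ] → ρ ⊢ `tail e ⇓ tail v [ suc t ]
      ⇓then : ∀ {e e₁ e₂ a b v s t} →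
              ρ ⊢ e ⇓ a ∙ b [ s ] → ρ ⊢ e₁ ⇓ v [ t ] →
              ρ ⊢ (if e then e₁ else e₂) ⇓ v [ suc (s + t) ]
      ⇓else : ∀ {e e₁ e₂ v s t} →
              ρ ⊢ e ⇓ nil [ s ] → ρ ⊢ e₂ ⇓ v [ t ] →
              ρ ⊢ (if e then e₁ else e₂) ⇓ v [ suc (s + t) ]
      ⇓call : ∀ {g es vs v s t} →
              ρ ⊢ es ⇓* vs [ s ] → vs ⊢ body g ⇓ v [ t ] →
              ρ ⊢ call g es ⇓ v [ suc (s + t) ]

    data _⊢_⇓*_[_] {m : ℕ} (ρ : Vec Tree m) :
           ∀ {k} → Vec (Exp arity m) k → Vec Tree k → ℕ → Set where
      ⇓[] : ρ ⊢ [] ⇓* [] [ 0 ]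
      ⇓∷  : ∀ {k e v s t} {es : Vec (Exp arity m) k} {vs} →
            ρ ⊢ e ⇓ v [ s ] → ρ ⊢ es ⇓* vs [ t ] →
            ρ ⊢ e ∷ es ⇓* v ∷ vs [ s + t ]

-- `p` maps `input` to `output` in exactly t steps.
Computes : Program → (input output : Tree) (t : ℕ) → Set
Computes p input output t = (input ∷ []) ⊢ main ⇓ output [ t ]
  where
  open Program p
  open Semantics arity body

------------------------------------------------------------------------
-- Encodings

encodeBool : Bool → Tree
encodeBool false = nil
encodeBool true  = nil ∙ nil

encodeList : List Tree → Tree
encodeList = foldr _∙_ nil

-- The adjacency matrix, row by row.
encodeGraph : ∀ {n} → Graph n → Tree
encodeGraph G =
  encodeList (tabulate λ u → encodeList (tabulate λ v → encodeBool (edge u v)))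
  where open Graph G

-- The characteristic vector.
encodeSubset : ∀ {n} → Subset n → Tree
encodeSubset S = encodeList (map encodeBool (Vec.toList S))

encodeSubsets : ∀ {n} → List (Subset n) → Tree
encodeSubsets Ss = encodeList (map encodeSubset Ss)

------------------------------------------------------------------------
-- Polynomial-time enumeration

-- Membership in the class is a promise: the program sees only the graph, and
-- nothing is required of it on graphs outside the class.  The time bound is on
-- the whole run, in terms of the size of the input only.  It also bounds the
-- explicit length of the output: the N cells of the spine of an encoded list
-- are pairwise different trees, so sharing cannot represent it by fewer nodes.
MISEnumerableInPolynomialTime : (∀ {n} → Graph n → Set) → Set
MISEnumerableInPolynomialTime Class =
  Σ Program λ p → ∃[ c ] ∃[ d ]
    (∀ {n} (G : Graph n) → Class G →
      ∃[ Ss ] ∃[ t ]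
        EnumeratesMaximalIndependentSets G Ss
        × Computes p (encodeGraph G) (encodeSubsets Ss) t
        × t ≤ c * size (encodeGraph G) ^ d)

{-# OPTIONS --safe #-}
module Submission where

-- Deleting vertex 0 from G leaves an induced subgraph G′, and every independent
-- set of G lies below S or {0} ∪ (S ∖ N(0)) for some maximal independent set S
-- of G′.  So the maximal independent sets of G are the inclusion-maximal ones
-- among these candidates, which are at most twice as many as those of G′.
--
-- In a (1,ℓ)-graph a maximal independent set meets each clique of the partition
-- in at most one vertex, and it is determined by these traces: two independent
-- sets with the same traces have an independent union.  Hence there are at most
-- (n + 1)^ℓ of them.  The class is hereditary, so this bounds all the
-- intermediate lists, although the program knows no partition.

open import Defs
open import Data.Bool.Base using (Bool; T)
open import Data.Bool.Properties using (T-≡)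
open import Data.Empty using (⊥-elim)
open import Data.Fin.Base using (Fin; zero; suc; funToFin; finToFun)
open import Data.Fin.Properties using (finToFun-funToFin; injective⇒≤; suc-injective; any?; _≟_)
open import Data.Fin.Subset
  using (Subset; inside; outside; _∈_; _∉_; _⊆_; _─_; _∪_)
open import Data.Fin.Subset.Properties
  using (_∈?_; _⊆?_; ⊆-refl; ⊆-trans; ⊆-antisym; out⊆; in⊆in;
         p─q⊆p; x∈p∧x∉q⇒x∈p─q; p⊆p∪q; q⊆p∪q; x∈p∪q⁻)
open import Data.List.Base using (List; []; _∷_; length; lookup; tabulate)
import Data.List.Membership.Propositional as List
open import Data.List.Membership.Propositional.Properties using (∈-lookup)
open import Data.List.Relation.Unary.All as All using (All; []; _∷_)
open import Data.List.Relation.Unary.AllPairs as AllPairs using (AllPairs; []; _∷_)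
open import Data.List.Relation.Unary.Any as Any using (Any; here; there)
open import Data.List.Relation.Unary.Unique.Propositional using (Unique)
open import Data.Nat.Base using (ℕ; zero; suc; _+_; _*_; _^_; _≤_; z≤n; s≤s)
open import Data.Nat.Properties
  using (≤-refl; ≤-trans; ≤-reflexive; m≤m+n; m≤n+m; m+n≤o⇒m≤o; m+n≤o⇒n≤o; n≤1+n;
         +-identityʳ; +-suc;
         +-mono-≤; +-monoˡ-≤; *-mono-≤; *-monoˡ-≤; *-monoʳ-≤;
         ^-monoˡ-≤; ^-distribˡ-+-*; m^n>0; module ≤-Reasoning)
open import Data.Nat.Tactic.RingSolver using (solve-∀)
open import Data.Product.Base using (_×_; _,_; proj₁; proj₂)
open import Data.Sum.Base using (_⊎_; inj₁; inj₂; [_,_]′)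
open import Data.Sum.Properties using (≡-dec)
open import Data.Vec.Base as Vec using (Vec; []; _∷_; here; there)
open import Data.Vec.Properties using ([]=⇒lookup; lookup⇒[]=; lookup∘tabulate)
open import Function.Base using (_∘_)
open import Function.Bundles using (mk⇔; Equivalence)
open import Function.Definitions using (Injective)
open import Relation.Binary.PropositionalEquality
  using (_≡_; refl; sym; trans; cong; subst)
open import Relation.Nullary using (¬_; Dec; yes; no; does; contradiction)
open import Relation.Nullary.Decidable using (_×-dec_)

private variable
  n k ℓ : ℕ

-- Enumeration by deleting a vertex

deleteZero : Graph (suc n) → Graph n
deleteZero G = record
  { edge     = λ u v → edge (suc u) (suc v)
  ; symm     = λ u v → symm (suc u) (suc v)
  ; loopless = λ v → loopless (suc v)
  } where open Graph G

neighbours : Graph (suc n) → Subset n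
neighbours G = Vec.tabulate λ v → Graph.edge G zero (suc v)

extend : Subset n → List (Subset n) → List (Subset (suc n))
extend N []       = []
extend N (S ∷ Ss) = (outside ∷ S) ∷ (inside ∷ (S ─ N)) ∷ extend N Ss

-- `acc` holds the sets already kept. Testing `S` against the later candidates as well as `acc` also
-- removes duplicates: of several equal candidates only the last can survive.
prune : (Ss acc : List (Subset n)) → List (Subset n)
prune []       acc = acc
prune (S ∷ Ss) acc with Any.any? (S ⊆?_) Ss | Any.any? (S ⊆?_) acc
... | yes _ | _     = prune Ss acc
... | no  _ | yes _ = prune Ss acc
... | no  _ | no  _ = prune Ss (S ∷ acc)

maximalIndependentSets : Graph n → List (Subset n)
maximalIndependentSets {zero}  G = [] ∷ []
maximalIndependentSets {suc n} G =
  prune (extend (neighbours G) (maximalIndependentSets (deleteZero G))) []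

-- Correctness of the enumeration

Incomparable : Subset n → Subset n → Set
Incomparable S S′ = ¬ S ⊆ S′ × ¬ S′ ⊆ S

prune-All : ∀ {P : Subset n → Set} Ss acc → All P Ss → All P acc → All P (prune Ss acc)
prune-All []       acc []       qs = qs
prune-All (S ∷ Ss) acc (p ∷ ps) qs
  with Any.any? (S ⊆?_) Ss | Any.any? (S ⊆?_) acc
... | yes _ | _     = prune-All Ss acc ps qs
... | no  _ | yes _ = prune-All Ss acc ps qs
... | no  _ | no  _ = prune-All Ss (S ∷ acc) ps (p ∷ qs)

-- A set is discarded only when some remaining or kept set contains it; by transitivity that set
-- takes over as the cover of `X`.
prune-covers : ∀ {X : Subset n} Ss acc →
               Any (X ⊆_) Ss ⊎ Any (X ⊆_) acc → Any (X ⊆_) (prune Ss acc)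
prune-covers []       acc (inj₂ q) = q
prune-covers {X = X} (S ∷ Ss) acc p
  with Any.any? (S ⊆?_) Ss | Any.any? (S ⊆?_) acc | p
... | yes s | _     | inj₁ (here X⊆S) =
  prune-covers Ss acc (inj₁ (Any.map (λ {Y} → ⊆-trans {i = X} {S} {Y} X⊆S) s))
... | yes _ | _     | inj₁ (there q)  = prune-covers Ss acc (inj₁ q)
... | yes _ | _     | inj₂ q          = prune-covers Ss acc (inj₂ q)
... | no  _ | yes s | inj₁ (here X⊆S) =
  prune-covers Ss acc (inj₂ (Any.map (λ {Y} → ⊆-trans {i = X} {S} {Y} X⊆S) s))
... | no  _ | yes _ | inj₁ (there q)  = prune-covers Ss acc (inj₁ q)
... | no  _ | yes _ | inj₂ q          = prune-covers Ss acc (inj₂ q)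
... | no  _ | no  _ | inj₁ (here X⊆S) = prune-covers Ss (S ∷ acc) (inj₂ (here X⊆S))
... | no  _ | no  _ | inj₁ (there q)  = prune-covers Ss (S ∷ acc) (inj₁ q)
... | no  _ | no  _ | inj₂ q          = prune-covers Ss (S ∷ acc) (inj₂ (there q))

-- Invariant: no kept set lies below a remaining one. When `S` is kept, the failed test against
-- `acc` excludes one direction of comparability and the invariant the other; the failed test
-- against `Ss` restores the invariant.
prune-antichain : ∀ (Ss acc : List (Subset n)) →
                  All (λ Y → ¬ Any (Y ⊆_) Ss) acc → AllPairs Incomparable acc →
                  AllPairs Incomparable (prune Ss acc)
prune-antichain []       acc _  qs = qs
prune-antichain (S ∷ Ss) acc ps qs
  with Any.any? (S ⊆?_) Ss | Any.any? (S ⊆?_) acc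
... | yes _  | _     = prune-antichain Ss acc (All.map (_∘ there) ps) qs
... | no  _  | yes _ = prune-antichain Ss acc (All.map (_∘ there) ps) qs
... | no S⊈Ss | no S⊈acc =
  prune-antichain Ss (S ∷ acc) (S⊈Ss ∷ All.map (_∘ there) ps)
    (All.tabulate (λ Y∈acc → (λ S⊆Y → S⊈acc (List.lose Y∈acc S⊆Y))
                           , All.lookup ps Y∈acc ∘ here) ∷ qs)

∈-neighbours⁺ : ∀ (G : Graph (suc n)) {v} → Adjacent G zero (suc v) → v ∈ neighbours G
∈-neighbours⁺ G {v} uv =
  lookup⇒[]= v _ (trans (lookup∘tabulate _ v) (Equivalence.to T-≡ uv))

∈-neighbours⁻ : ∀ (G : Graph (suc n)) {v} → v ∈ neighbours G → Adjacent G zero (suc v)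
∈-neighbours⁻ G {v} v∈N =
  Equivalence.from T-≡ (trans (sym (lookup∘tabulate _ v)) ([]=⇒lookup v∈N))

∈─⇒∉ : ∀ {x} (p q : Subset n) → x ∈ p ─ q → x ∉ q
∈─⇒∉ (_ ∷ p) (inside  ∷ q) (there x∈) (there x∈q) = ∈─⇒∉ p q x∈ x∈q
∈─⇒∉ (_ ∷ p) (outside ∷ q) (there x∈) (there x∈q) = ∈─⇒∉ p q x∈ x∈q

module _ {n} (G : Graph n) where

  adjacent-sym : ∀ {u v} → Adjacent G u v → Adjacent G v u
  adjacent-sym {u} {v} = subst T (Graph.symm G u v)

  irreflexive : ∀ {v} → ¬ Adjacent G v v
  irreflexive {v} = subst T (Graph.loopless G v)

module _ {n} (G : Graph (suc n)) where

  private G′ = deleteZero G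

  independent-outside : ∀ {S} → IsIndependent G′ (_∈ S) → IsIndependent G (_∈ outside ∷ S)
  independent-outside indep (there u∈S) (there v∈S) = indep u∈S v∈S

  independent-inside : ∀ {S} → IsIndependent G′ (_∈ S) →
                       IsIndependent G (_∈ inside ∷ (S ─ neighbours G))
  independent-inside {S} indep here       here       = irreflexive G
  independent-inside {S} indep here       (there v∈) = ∈─⇒∉ S _ v∈ ∘ ∈-neighbours⁺ G
  independent-inside {S} indep (there u∈) here       = ∈─⇒∉ S _ u∈ ∘ ∈-neighbours⁺ G ∘ adjacent-sym G
  independent-inside {S} indep (there u∈) (there v∈) = indep (p─q⊆p S _ u∈) (p─q⊆p S _ v∈)

  independent-tail : ∀ {s S} → IsIndependent G (_∈ s ∷ S) → IsIndependent G′ (_∈ S)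
  independent-tail indep u∈S v∈S = indep (there u∈S) (there v∈S)

  extend-independent : ∀ {Ss} → All (λ S → IsIndependent G′ (_∈ S)) Ss →
                       All (λ S → IsIndependent G (_∈ S)) (extend (neighbours G) Ss)
  extend-independent []             = []
  extend-independent {S ∷ _} (p ∷ ps) =
    (λ {u} {v} → independent-outside {S} p {u} {v}) ∷
    (λ {u} {v} → independent-inside {S} p {u} {v}) ∷ extend-independent ps

-- If vertex 0 is absent, the cover of `X` still works. If it is present, `X` avoids `N`, so
-- removing `N` from the cover loses nothing of `X`.
extend-covers : ∀ (N : Subset n) {Ss s X} → Any (X ⊆_) Ss →
                (s ≡ inside → ∀ {x} → x ∈ X → x ∉ N) → Any (s ∷ X ⊆_) (extend N Ss)
extend-covers N {s = outside} (here X⊆S) _ = here (out⊆ X⊆S)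
extend-covers N {s = inside}  (here X⊆S) X∩N≡∅ =
  there (here (in⊆in (λ x∈X → x∈p∧x∉q⇒x∈p─q (X⊆S x∈X) (X∩N≡∅ refl x∈X))))
extend-covers N (there p) X∩N≡∅ = there (there (extend-covers N p X∩N≡∅))

mis-independent : ∀ (G : Graph n) →
                  All (λ S → IsIndependent G (_∈ S)) (maximalIndependentSets G)
mis-independent {zero}  G = (λ ()) ∷ []
mis-independent {suc n} G =
  prune-All _ [] (extend-independent G (mis-independent (deleteZero G))) []

mis-covers : ∀ (G : Graph n) X → IsIndependent G (_∈ X) →
             Any (X ⊆_) (maximalIndependentSets G)
mis-covers {zero}  G []      _     = here ⊆-refl
mis-covers {suc n} G (s ∷ X) indep =
  prune-covers _ [] (inj₁ (extend-covers (neighbours G)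
    (mis-covers (deleteZero G) X (independent-tail G indep))
    λ { refl x∈X x∈N → indep here (there x∈X) (∈-neighbours⁻ G x∈N) }))

mis-antichain : ∀ (G : Graph n) → AllPairs Incomparable (maximalIndependentSets G)
mis-antichain {zero}  G = [] ∷ []
mis-antichain {suc n} G =
  prune-antichain (extend (neighbours G) (maximalIndependentSets (deleteZero G))) [] [] []

antichain⇒unique : ∀ {Ss : List (Subset n)} → AllPairs Incomparable Ss → Unique Ss
antichain⇒unique = AllPairs.map λ { (S⊈S , _) refl → S⊈S ⊆-refl }

antichain-⊆⇒≡ : ∀ {Ss : List (Subset n)} → AllPairs Incomparable Ss →
                ∀ {S S′} → S List.∈ Ss → S′ List.∈ Ss → S ⊆ S′ → S ≡ S′
antichain-⊆⇒≡ _        (here refl) (here refl) _    = refl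
antichain-⊆⇒≡ (p ∷ _)  (here refl) (there q)   S⊆S′ = ⊥-elim (proj₁ (All.lookup p q) S⊆S′)
antichain-⊆⇒≡ (p ∷ _)  (there q)   (here refl) S⊆S′ = ⊥-elim (proj₂ (All.lookup p q) S⊆S′)
antichain-⊆⇒≡ (_ ∷ ps) (there q)   (there q′)  S⊆S′ = antichain-⊆⇒≡ ps q q′ S⊆S′

maximal-⊆⇒≡ : ∀ (G : Graph n) {S S′} → IsMaximalIndependent G S →
              IsIndependent G (_∈ S′) → S ⊆ S′ → S ≡ S′
maximal-⊆⇒≡ G {S} {S′} (_ , maximal) indep S⊆S′ = ⊆-antisym S⊆S′ S′⊆S
  where
  S′⊆S : S′ ⊆ S
  S′⊆S {x} x∈S′ with x ∈? S
  ... | yes x∈S = x∈S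
  ... | no  x∉S = ⊥-elim (maximal S′ indep (S⊆S′ , x , x∈S′ , x∉S))

-- A covering antichain of independent sets is exactly the family of maximal ones. An independent
-- proper superset of a listed set would lie below another listed set, against the antichain
-- property; a maximal set lies below a listed independent set and so equals it.
mis-enumerates : ∀ (G : Graph n) → EnumeratesMaximalIndependentSets G (maximalIndependentSets G)
mis-enumerates G = antichain⇒unique (mis-antichain G) , λ S → mk⇔ (sound S) (complete S)
  where
  Ss = maximalIndependentSets G

  sound : ∀ S → S List.∈ Ss → IsMaximalIndependent G S
  sound S S∈ = All.lookup (mis-independent G) S∈ , maximal
    where
    maximal : ∀ S′ → IsIndependent G (_∈ S′) → _
    maximal S′ indep (S⊆S′ , x , x∈S′ , x∉S)
      with M , M∈ , S′⊆M ← List.find (mis-covers G S′ indep)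
      with refl ← antichain-⊆⇒≡ (mis-antichain G) S∈ M∈ (⊆-trans {i = S} {S′} {M} S⊆S′ S′⊆M)
      = x∉S (S′⊆M x∈S′)

  complete : ∀ S → IsMaximalIndependent G S → S List.∈ Ss
  complete S max@(indep , _) with M , M∈ , S⊆M ← List.find (mis-covers G S indep)
    with refl ← maximal-⊆⇒≡ G max (λ {u} {v} → All.lookup (mis-independent G) M∈ {u} {v}) S⊆M = M∈

-- Counting in (1,ℓ)-graphs

lookup-injective : ∀ {A : Set} {xs : List A} → Unique xs → Injective _≡_ _≡_ (lookup xs)
lookup-injective (_ ∷ _)  {zero}  {zero}  _  = refl
lookup-injective (p ∷ _)  {zero}  {suc j} eq = contradiction eq (All.lookup p (∈-lookup j))
lookup-injective (p ∷ _)  {suc i} {zero}  eq = contradiction (sym eq) (All.lookup p (∈-lookup i))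
lookup-injective (_ ∷ ps) {suc i} {suc j} eq = cong suc (lookup-injective ps eq)

module _ {n ℓ} (G : Graph n) (π : KLPartition G 1 ℓ) where

  open KLPartition π

  private
    inClique? : ∀ S j v → Dec (v ∈ S × part v ≡ inj₂ j)
    inClique? S j v = (v ∈? S) ×-dec ≡-dec _≟_ _≟_ (part v) (inj₂ j)

  -- The vertex of S in the j-th clique, shifted by one; zero if there is none.
  trace : Subset n → Fin ℓ → Fin (suc n)
  trace S j with any? (inClique? S j)
  ... | yes (v , _) = suc v
  ... | no  _       = zero

  -- The search may return another vertex `v` than `u`, but two distinct vertices of a clique are
  -- adjacent, so both cannot lie in `S`.
  trace-∈⁺ : ∀ {S u j} → IsIndependent G (_∈ S) → u ∈ S → part u ≡ inj₂ j → trace S j ≡ suc u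
  trace-∈⁺ {S} {u} {j} indep u∈S u∈K with any? (inClique? S j)
  ... | no  none              = contradiction (u , u∈S , u∈K) none
  ... | yes (v , v∈S , v∈K) with v ≟ u
  ...   | yes v≡u = cong suc v≡u
  ...   | no  v≢u = contradiction (clique j v∈K u∈K v≢u) (indep v∈S u∈S)

  trace-∈⁻ : ∀ {S u j} → trace S j ≡ suc u → u ∈ S
  trace-∈⁻ {S} {u} {j} eq with any? (inClique? S j)
  ... | yes (v , v∈S , _) = subst (_∈ S) (suc-injective eq) v∈S

  -- Only an edge between `S` and `S′` could be a problem. If an endpoint lies in a clique part,
  -- equality of the traces puts it into the other set too, and both endpoints lie in one
  -- independent set.
  equal-traces⇒∪-independent : ∀ {S S′} → IsIndependent G (_∈ S) → IsIndependent G (_∈ S′) →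
    (∀ j → trace S j ≡ trace S′ j) → IsIndependent G (_∈ S ∪ S′)
  equal-traces⇒∪-independent {S} {S′} indep indep′ eq {u} {v} u∈ v∈ =
    [ (λ u∈S → [ indep u∈S , cross u∈S ]′ v∈S∪S′)
    , (λ u∈S′ → [ (λ v∈S → cross v∈S u∈S′ ∘ adjacent-sym G) , indep′ u∈S′ ]′ v∈S∪S′)
    ]′ (x∈p∪q⁻ S S′ u∈)
    where
    v∈S∪S′ = x∈p∪q⁻ S S′ v∈

    cross : ∀ {x y} → x ∈ S → y ∈ S′ → ¬ Adjacent G x y
    cross {x} {y} x∈S y∈S′ with part x in x∈K | part y in y∈K
    ... | inj₂ j    | _         =
      indep′ (trace-∈⁻ (trans (sym (eq j)) (trace-∈⁺ indep x∈S x∈K))) y∈S′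
    ... | inj₁ _    | inj₂ j    =
      indep x∈S (trace-∈⁻ (trans (eq j) (trace-∈⁺ indep′ y∈S′ y∈K)))
    -- There is a single independent part, so it contains both endpoints.
    ... | inj₁ zero | inj₁ zero = independent zero x∈K y∈K

  -- By maximality, both sets equal their independent union.
  trace-injective : ∀ {S S′} → IsMaximalIndependent G S → IsMaximalIndependent G S′ →
                    (∀ j → trace S j ≡ trace S′ j) → S ≡ S′
  trace-injective {S} {S′} max max′ eq =
    trans (maximal-⊆⇒≡ G max indep∪ (p⊆p∪q S′)) (sym (maximal-⊆⇒≡ G max′ indep∪ (q⊆p∪q S S′)))
    where
    indep∪ : IsIndependent G (_∈ S ∪ S′)
    indep∪ = equal-traces⇒∪-independent (proj₁ max) (proj₁ max′) eq

  -- Pigeonhole: `funToFin` codes a trace as one of `suc n ^ ℓ` numbers, and list positions with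
  -- equal codes have pointwise equal traces.
  enumeration-length : ∀ {Ss} → EnumeratesMaximalIndependentSets G Ss → length Ss ≤ suc n ^ ℓ
  enumeration-length {Ss} (unique , enumerates) =
    injective⇒≤ {f = λ i → funToFin (trace (lookup Ss i))} λ {i} {i′} eq →
      lookup-injective unique (trace-injective (maximal i) (maximal i′) λ j →
        trans (sym (finToFun-funToFin (trace (lookup Ss i)) j))
              (trans (cong (λ c → finToFun c j) eq) (finToFun-funToFin (trace (lookup Ss i′)) j)))
    where
    maximal : ∀ i → IsMaximalIndependent G (lookup Ss i)
    maximal i = Equivalence.to (enumerates _) (∈-lookup i)

deleteZero-partition : ∀ {G : Graph (suc n)} → KLPartition G k ℓ → KLPartition (deleteZero G) k ℓ
deleteZero-partition π = record
  { part        = part ∘ suc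
  ; independent = λ i u∈ v∈ → independent i u∈ v∈
  ; clique      = λ j u∈ v∈ u≢v → clique j u∈ v∈ (u≢v ∘ suc-injective)
  } where open KLPartition π

-- The program

arity : Fin 7 → ℕ
arity = Vec.lookup (1 ∷ 2 ∷ 2 ∷ 2 ∷ 2 ∷ 2 ∷ 1 ∷ [])

pattern `columns = zero
pattern `diff    = suc zero
pattern `extend  = suc (suc zero)
pattern `⊆       = suc (suc (suc zero))
pattern `any⊆    = suc (suc (suc (suc zero)))
pattern `prune   = suc (suc (suc (suc (suc zero))))
pattern `mis     = suc (suc (suc (suc (suc (suc zero)))))

pattern x₀ = var zero
pattern x₁ = var (suc zero)

`false `true : Exp arity k
`false = `nil
`true  = `cons `nil `nil

body : (g : Fin 7) → Exp arity (arity g)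
body `columns =
  if x₀ then `cons (`tail (`head x₀)) (call `columns (`tail x₀ ∷ []))
  else `nil
body `diff =
  if x₀ then `cons (if `head x₁ then `false else `head x₀) (call `diff (`tail x₀ ∷ `tail x₁ ∷ []))
  else `nil
body `extend =
  if x₀ then `cons (`cons `false (`head x₀))
            (`cons (`cons `true (call `diff (`head x₀ ∷ x₁ ∷ [])))
                   (call `extend (`tail x₀ ∷ x₁ ∷ [])))
  else `nil
body `⊆ =
  if x₀ then
    (if `head x₀ then
       (if `head x₁ then call `⊆ (`tail x₀ ∷ `tail x₁ ∷ []) else `false)
     else call `⊆ (`tail x₀ ∷ `tail x₁ ∷ []))
  else `true
body `any⊆ =
  if x₁ then
    (if call `⊆ (x₀ ∷ `head x₁ ∷ []) then `true else call `any⊆ (x₀ ∷ `tail x₁ ∷ []))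
  else `false
body `prune =
  if x₀ then
    (if call `any⊆ (`head x₀ ∷ `tail x₀ ∷ []) then call `prune (`tail x₀ ∷ x₁ ∷ [])
     else if call `any⊆ (`head x₀ ∷ x₁ ∷ []) then call `prune (`tail x₀ ∷ x₁ ∷ [])
     else call `prune (`tail x₀ ∷ `cons (`head x₀) x₁ ∷ []))
  else x₁
body `mis =
  if x₀ then
    call `prune
      -- `tail x₀` drops row 0 and `columns` drops column 0, which leaves the matrix of
      -- `deleteZero G`. Row 0 without its diagonal entry is the characteristic vector of the
      -- neighbours of vertex 0.
      ( call `extend ( call `mis (call `columns (`tail x₀ ∷ []) ∷ [])
                     ∷ `tail (`head x₀) ∷ [])
      ∷ `nil ∷ [])
  -- The one-element list holding the empty subset, whose characteristic vector is `nil`.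
  else `cons `nil `nil

program : Program
program = record { arity = arity ; body = body ; main = call `mis (x₀ ∷ []) }

open Semantics arity body

-- Time bounds

infix 4 _⊢_⇓_within_ _⊢_⇓*_within_

-- Hiding the exact step count behind an upper bound lets branches of different cost share one
-- bound.
record _⊢_⇓_within_ {m} (ρ : Vec Tree m) (e : Exp arity m) (v : Tree) (b : ℕ) : Set where
  constructor _,_
  field
    {steps}    : ℕ
    derivation : ρ ⊢ e ⇓ v [ steps ]
    bounded    : steps ≤ b

record _⊢_⇓*_within_ {m k} (ρ : Vec Tree m) (es : Vec (Exp arity m) k) (vs : Vec Tree k)
                     (b : ℕ) : Set where
  constructor _,_
  field
    {steps}    : ℕ
    derivation : ρ ⊢ es ⇓* vs [ steps ]
    bounded    : steps ≤ b

private variable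
  m a b         : ℕ
  ρ             : Vec Tree m
  d e e₁ e₂     : Exp arity m
  es            : Vec (Exp arity m) k
  v w           : Tree
  vs            : Vec Tree k

weaken : a ≤ b → ρ ⊢ e ⇓ v within a → ρ ⊢ e ⇓ v within b
weaken a≤b (D , s≤a) = D , ≤-trans s≤a a≤b

run-var : ∀ {x} → ρ ⊢ var x ⇓ Vec.lookup ρ x within 1
run-var = ⇓var , ≤-refl

run-nil : ρ ⊢ `nil ⇓ nil within 1
run-nil = ⇓nil , ≤-refl

run-cons : ρ ⊢ d ⇓ v within a → ρ ⊢ e ⇓ w within b → ρ ⊢ `cons d e ⇓ v ∙ w within suc (a + b)
run-cons (D , p) (E , q) = ⇓cons D E , s≤s (+-mono-≤ p q)

run-head : ρ ⊢ e ⇓ v within a → ρ ⊢ `head e ⇓ head v within suc a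
run-head (D , p) = ⇓head D , s≤s p

run-tail : ρ ⊢ e ⇓ v within a → ρ ⊢ `tail e ⇓ tail v within suc a
run-tail (D , p) = ⇓tail D , s≤s p

run-then : ∀ {v₁ v₂} → ρ ⊢ e ⇓ v₁ ∙ v₂ within a → ρ ⊢ e₁ ⇓ w within b →
           ρ ⊢ if e then e₁ else e₂ ⇓ w within suc (a + b)
run-then (D , p) (E , q) = ⇓then D E , s≤s (+-mono-≤ p q)

run-else : ρ ⊢ e ⇓ nil within a → ρ ⊢ e₂ ⇓ w within b →
           ρ ⊢ if e then e₁ else e₂ ⇓ w within suc (a + b)
run-else (D , p) (E , q) = ⇓else D E , s≤s (+-mono-≤ p q)

run-call : ∀ {g} {es : Vec (Exp arity m) (arity g)} {vs} →
           ρ ⊢ es ⇓* vs within a → vs ⊢ body g ⇓ w within b →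
           ρ ⊢ call g es ⇓ w within suc (a + b)
run-call (D , p) (E , q) = ⇓call D E , s≤s (+-mono-≤ p q)

run-[] : ρ ⊢ [] ⇓* [] within 0
run-[] = ⇓[] , z≤n

infixr 5 _run-∷_

_run-∷_ : ρ ⊢ e ⇓ v within a → ρ ⊢ es ⇓* vs within b → ρ ⊢ e ∷ es ⇓* v ∷ vs within (a + b)
(D , p) run-∷ (E , q) = ⇓∷ D E , +-mono-≤ p q

-- Running times of the individual functions

encodeMatrix : (Fin m → Fin n → Bool) → Tree
encodeMatrix M = encodeList (tabulate λ u → encodeList (tabulate λ v → encodeBool (M u v)))

encodeSubset-tabulate : (f : Fin n → Bool) →
  encodeList (tabulate (λ v → encodeBool (f v))) ≡ encodeSubset (Vec.tabulate f)
encodeSubset-tabulate {zero}  f = refl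
encodeSubset-tabulate {suc n} f = cong (encodeBool (f zero) ∙_) (encodeSubset-tabulate (f ∘ suc))

-- Each coefficient is the cost of one recursive step along the longest branch,
-- each constant that of the base case.
columnsTime ⊆Time diffTime : ℕ → ℕ
columnsTime m = m * 9 + 3
⊆Time       n = n * 13 + 5
diffTime    n = n * 13 + 3

extendTime any⊆Time : ℕ → ℕ → ℕ
extendTime n k = k * (20 + diffTime n) + 3
any⊆Time   n k = k * (11 + ⊆Time n) + 3

pruneTime : ℕ → ℕ → ℕ → ℕ
pruneTime n b k = k * (20 + (any⊆Time n b + any⊆Time n b)) + 3

-- Stated for rectangular matrices, since the recursion removes rows while the width stays fixed.
run-columns : (M : Fin m → Fin (suc n) → Bool) →
  encodeMatrix M ∷ [] ⊢ body `columns ⇓ encodeMatrix (λ u v → M u (suc v)) within columnsTime m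
run-columns {zero}  M = run-else run-var run-nil
run-columns {suc m} M =
  run-then run-var (run-cons (run-tail (run-head run-var))
    (run-call (run-tail run-var run-∷ run-[]) (run-columns (M ∘ suc))))

run-diff : (S N : Subset n) →
  encodeSubset S ∷ encodeSubset N ∷ [] ⊢ body `diff ⇓ encodeSubset (S ─ N) within diffTime n
run-diff [] [] = run-else run-var run-nil
run-diff (s ∷ S) (outside ∷ N) =
  run-then run-var (run-cons (run-else (run-head run-var) (run-head run-var))
    (run-call (run-tail run-var run-∷ run-tail run-var run-∷ run-[]) (run-diff S N)))
-- The spare step: this branch evaluates `nil` in place of `head x₀`.
run-diff (s ∷ S) (inside ∷ N) = weaken (n≤1+n _)
  (run-then run-var (run-cons (run-then (run-head run-var) run-nil)
    (run-call (run-tail run-var run-∷ run-tail run-var run-∷ run-[]) (run-diff S N))))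

run-⊆ : (S S′ : Subset n) →
  encodeSubset S ∷ encodeSubset S′ ∷ [] ⊢ body `⊆ ⇓ encodeBool (does (S ⊆? S′)) within ⊆Time n
run-⊆ [] [] = run-else run-var (run-cons run-nil run-nil)
run-⊆ (outside ∷ S) (s ∷ S′) = weaken (m≤n+m _ 3)
  (run-then run-var (run-else (run-head run-var)
    (run-call (run-tail run-var run-∷ run-tail run-var run-∷ run-[]) (run-⊆ S S′))))
run-⊆ (inside ∷ S) (outside ∷ S′) = weaken (m≤m+n 9 _)
  (run-then run-var (run-then (run-head run-var) (run-else (run-head run-var) run-nil)))
run-⊆ (inside ∷ S) (inside ∷ S′) =
  run-then run-var (run-then (run-head run-var) (run-then (run-head run-var)
    (run-call (run-tail run-var run-∷ run-tail run-var run-∷ run-[]) (run-⊆ S S′))))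

run-any⊆ : (S : Subset n) (Ss : List (Subset n)) →
  encodeSubset S ∷ encodeSubsets Ss ∷ []
    ⊢ body `any⊆ ⇓ encodeBool (does (Any.any? (S ⊆?_) Ss)) within any⊆Time n (length Ss)
run-any⊆ S [] = run-else run-var run-nil
run-any⊆ {n} S (S′ ∷ Ss) with S ⊆? S′ | run-⊆ S S′
-- The search stops early; the slack `4 + r` covers the recursion that is skipped.
... | yes _ | test = weaken (≤-trans (m≤m+n _ (4 + r)) (≤-reflexive (found (⊆Time n) r)))
  (run-then run-var (run-then (run-call (run-var run-∷ run-head run-var run-∷ run-[]) test)
    (run-cons run-nil run-nil)))
  where
  r = length Ss * (11 + ⊆Time n)

  found : ∀ t r → 7 + (t + 3) + (4 + r) ≡ 11 + t + r + 3
  found = solve-∀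
... | no _ | test = weaken (≤-reflexive (notFound (⊆Time n) (length Ss * (11 + ⊆Time n))))
  (run-then run-var (run-else (run-call (run-var run-∷ run-head run-var run-∷ run-[]) test)
    (run-call (run-var run-∷ run-tail run-var run-∷ run-[]) (run-any⊆ S Ss))))
  where
  notFound : ∀ t r → 7 + (t + (4 + (r + 3))) ≡ 11 + t + r + 3
  notFound = solve-∀

run-extend : (N : Subset n) (Ss : List (Subset n)) →
  encodeSubsets Ss ∷ encodeSubset N ∷ []
    ⊢ body `extend ⇓ encodeSubsets (extend N Ss) within extendTime n (length Ss)
run-extend N [] = run-else run-var run-nil
run-extend {n} N (S ∷ Ss) = weaken (≤-reflexive (eq (diffTime n) (length Ss * (20 + diffTime n))))
  (run-then run-var (run-cons (run-cons run-nil (run-head run-var))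
    (run-cons (run-cons (run-cons run-nil run-nil)
                (run-call (run-head run-var run-∷ run-var run-∷ run-[]) (run-diff S N)))
              (run-call (run-tail run-var run-∷ run-var run-∷ run-[]) (run-extend N Ss)))))
  where
  eq : ∀ t r → 16 + (t + (4 + (r + 3))) ≡ 20 + t + r + 3
  eq = solve-∀

run-any⊆-≤ : (S : Subset n) (Ss : List (Subset n)) → length Ss ≤ b →
  encodeSubset S ∷ encodeSubsets Ss ∷ []
    ⊢ body `any⊆ ⇓ encodeBool (does (Any.any? (S ⊆?_) Ss)) within any⊆Time n b
run-any⊆-≤ {n} S Ss l≤b = weaken (+-monoˡ-≤ 3 (*-monoˡ-≤ (11 + ⊆Time n) l≤b)) (run-any⊆ S Ss)

-- Each step drops a candidate or moves it to `acc`, so the two lengths together never exceed `b`.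
-- Hence every containment search costs at most `any⊆Time n b`.
run-prune : (Ss acc : List (Subset n)) → length Ss + length acc ≤ b →
  encodeSubsets Ss ∷ encodeSubsets acc ∷ []
    ⊢ body `prune ⇓ encodeSubsets (prune Ss acc) within pruneTime n b (length Ss)
run-prune [] acc _ = run-else run-var run-var
run-prune {n} {b} (S ∷ Ss) acc l≤b
  with Any.any? (S ⊆?_) Ss
     | run-any⊆-≤ {b = b} S Ss (m+n≤o⇒m≤o (length Ss) (≤-trans (n≤1+n _) l≤b))
     | Any.any? (S ⊆?_) acc
     | run-any⊆-≤ {b = b} S acc (m+n≤o⇒n≤o (suc (length Ss)) l≤b)
... | yes _ | test | _ | _ =
  -- The slack `8 + t` includes the second search, which is not run here.
  weaken (m+n≤o⇒m≤o _ (≤-reflexive (eq t r)))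
    (run-then run-var (run-then
      (run-call (run-head run-var run-∷ run-tail run-var run-∷ run-[]) test)
      (run-call (run-tail run-var run-∷ run-var run-∷ run-[])
        (run-prune Ss acc (≤-trans (n≤1+n _) l≤b)))))
  where
  t = any⊆Time n b
  r = length Ss * (20 + (t + t))

  eq : ∀ t r → 8 + (t + (4 + (r + 3))) + (8 + t) ≡ 20 + (t + t) + r + 3
  eq = solve-∀
... | no _ | test | yes _ | test′ =
  weaken (m+n≤o⇒m≤o _ (≤-reflexive (eq t r)))
    (run-then run-var (run-else
      (run-call (run-head run-var run-∷ run-tail run-var run-∷ run-[]) test)
      (run-then
        (run-call (run-head run-var run-∷ run-var run-∷ run-[]) test′)
        (run-call (run-tail run-var run-∷ run-var run-∷ run-[])
          (run-prune Ss acc (≤-trans (n≤1+n _) l≤b))))))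
  where
  t = any⊆Time n b
  r = length Ss * (20 + (t + t))

  eq : ∀ t r → 8 + (t + (5 + (t + (4 + (r + 3))))) + 3 ≡ 20 + (t + t) + r + 3
  eq = solve-∀
... | no _ | test | no _ | test′ =
  weaken (≤-reflexive (eq t r))
    (run-then run-var (run-else
      (run-call (run-head run-var run-∷ run-tail run-var run-∷ run-[]) test)
      (run-else
        (run-call (run-head run-var run-∷ run-var run-∷ run-[]) test′)
        (run-call (run-tail run-var run-∷ run-cons (run-head run-var) run-var run-∷ run-[])
          (run-prune Ss (S ∷ acc) (≤-trans (≤-reflexive (+-suc _ _)) l≤b))))))
  where
  t = any⊆Time n b
  r = length Ss * (20 + (t + t))

  eq : ∀ t r → 8 + (t + (5 + (t + (7 + (r + 3))))) ≡ 20 + (t + t) + r + 3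
  eq = solve-∀

length-extend : (N : Subset n) (Ss : List (Subset n)) → length (extend N Ss) ≡ length Ss + length Ss
length-extend N []       = refl
length-extend N (S ∷ Ss) = cong suc (trans (cong suc (length-extend N Ss)) (sym (+-suc _ _)))

-- With lists of at most `b` sets, one level of the recursion costs on the order of
-- `suc n * (suc b * suc b)`, mostly for pairwise containment tests in `prune`. Summing over the
-- levels gives the second factor `suc n`; 128 is large enough for the induction step.
misTime : ℕ → ℕ → ℕ
misTime n b = 128 * (suc n * suc n * (suc b * suc b))

-- The witness is the exact difference of the two sides, as a polynomial.
misTime-suc : ∀ n b →
  2 + (1 + (((1 + (((1 + ((3 + columnsTime n + 0) + misTime n b)) + 3) + extendTime n b)) + 1)
    + pruneTime (suc n) (b + b) (b + b))) ≤ misTime (suc n) b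
misTime-suc n b = m+n≤o⇒m≤o _ (≤-reflexive (eq n b))
  where
  eq : ∀ n b →
    2 + (1 + (((1 + (((1 + ((3 + (n * 9 + 3) + 0) + 128 * (suc n * suc n * (suc b * suc b)))) + 3)
      + (b * (20 + (n * 13 + 3)) + 3))) + 1)
      + ((b + b) * (20 + (((b + b) * (11 + (suc n * 13 + 5)) + 3) + ((b + b) * (11 + (suc n * 13 + 5)) + 3))) + 3)))
      + (363 + 247 * n + 693 * b + 499 * (n * b) + 152 * (b * b) + 152 * (n * (b * b)))
    ≡ 128 * (suc (suc n) * suc (suc n) * (suc b * suc b))
  eq = solve-∀

-- The bound `b` stays fixed through the recursion: smaller graphs inherit both the partition and
-- the inequality, so it bounds every intermediate list, and the candidates number at most `b + b`.
run-mis : (G : Graph n) → KLPartition G 1 ℓ → suc n ^ ℓ ≤ b →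
  encodeGraph G ∷ [] ⊢ body `mis ⇓ encodeSubsets (maximalIndependentSets G) within misTime n b
run-mis {zero} {b = b} G _ _ =
  weaken (≤-trans (m≤m+n 5 123) (*-monoʳ-≤ 128 (s≤s z≤n)))
    (run-else run-var (run-cons run-nil run-nil))
run-mis {suc n} {ℓ} {b} G π l≤b = weaken (misTime-suc n b)
  (run-then run-var (run-call
    (run-call
      (run-call
        (run-call (run-tail run-var run-∷ run-[]) (run-columns (λ u → Graph.edge G (suc u))) run-∷ run-[])
        (run-mis {b = b} G′ π′ l′≤b)
       -- The program reads a matrix row where `extend` expects an encoded subset; the two trees are
       -- equal.
       run-∷ subst (λ w → encodeGraph G ∷ [] ⊢ `tail (`head x₀) ⇓ w within 3)
               (encodeSubset-tabulate (λ v → Graph.edge G zero (suc v)))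
               (run-tail (run-head run-var))
       run-∷ run-[])
      (weaken (+-monoˡ-≤ 3 (*-monoˡ-≤ (20 + diffTime n) Ss≤b)) (run-extend N Ss))
     run-∷ run-nil run-∷ run-[])
    (weaken (+-monoˡ-≤ 3 (*-monoˡ-≤ (20 + (any⊆Time (suc n) (b + b) + any⊆Time (suc n) (b + b))) candidates≤b+b))
      (run-prune (extend N Ss) [] (≤-trans (≤-reflexive (+-identityʳ _)) candidates≤b+b)))))
  where
  G′ = deleteZero G
  π′ = deleteZero-partition π
  N  = neighbours G
  Ss = maximalIndependentSets G′

  l′≤b : suc n ^ ℓ ≤ b
  l′≤b = ≤-trans (^-monoˡ-≤ ℓ (n≤1+n (suc n))) l≤b

  Ss≤b : length Ss ≤ b
  Ss≤b = ≤-trans (enumeration-length G′ π′ (mis-enumerates G′)) l′≤b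

  candidates≤b+b : length (extend N Ss) ≤ b + b
  candidates≤b+b = ≤-trans (≤-reflexive (length-extend N Ss)) (+-mono-≤ Ss≤b Ss≤b)

-- Polynomial bound in the size of the input

size-tabulate : (f : Fin n → Tree) → suc n ≤ size (encodeList (tabulate f))
size-tabulate {zero}  f = s≤s z≤n
size-tabulate {suc n} f = s≤s (≤-trans (size-tabulate (f ∘ suc)) (m≤n+m _ _))

-- The 2 pays for the call in `main` and its argument. Since `1 + p ≤ p + p` for `p = N ^ ℓ`, the
-- square contributes a factor 4, and 514 is 2 + 128 * 4.
2+misTime≤ : ∀ ℓ {N} → suc n ≤ N → 2 + misTime n (N ^ ℓ) ≤ 514 * N ^ (2 + (ℓ + ℓ))
2+misTime≤ {n} ℓ {suc N-1} n<N = begin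
  2 + 128 * (suc n * suc n * (suc p * suc p))
    ≤⟨ +-mono-≤ (*-monoʳ-≤ 2 (m^n>0 N (2 + (ℓ + ℓ))))
                (*-monoʳ-≤ 128 (*-mono-≤ (*-mono-≤ n<N n<N) (*-mono-≤ 1+p≤p+p 1+p≤p+p))) ⟩
  2 * N ^ (2 + (ℓ + ℓ)) + 128 * (N * N * ((p + p) * (p + p)))
    ≡⟨ cong (λ q → 2 * (N * (N * q)) + 128 * (N * N * ((p + p) * (p + p)))) (^-distribˡ-+-* N ℓ ℓ) ⟩
  2 * (N * (N * (p * p))) + 128 * (N * N * ((p + p) * (p + p)))
    ≡⟨ eq N p ⟩
  514 * (N * (N * (p * p)))
    ≡⟨ cong (λ q → 514 * (N * (N * q))) (^-distribˡ-+-* N ℓ ℓ) ⟨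
  514 * N ^ (2 + (ℓ + ℓ)) ∎
  where
  open ≤-Reasoning
  N = suc N-1
  p = N ^ ℓ
  1+p≤p+p = +-monoˡ-≤ p (m^n>0 N ℓ)

  eq : ∀ x y → 2 * (x * (x * (y * y))) + 128 * (x * x * ((y + y) * (y + y))) ≡ 514 * (x * (x * (y * y)))
  eq = solve-∀

corollary4 : (ℓ : ℕ) → MISEnumerableInPolynomialTime (λ G → KLPartition G 1 ℓ)
corollary4 ℓ = program , 514 , 2 + (ℓ + ℓ) , λ {n} G π →
  let n<N = size-tabulate (λ u → encodeList (tabulate λ v → encodeBool (Graph.edge G u v)))
      -- The vertex count is below the input size, so the `ℓ`-th power of that size is an admissible
      -- `b`.
      D , t≤ = run-call (run-var run-∷ run-[]) (run-mis {b = size (encodeGraph G) ^ ℓ} G π (^-monoˡ-≤ ℓ n<N))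
  in maximalIndependentSets G , _ , mis-enumerates G , D , ≤-trans t≤ (2+misTime≤ {n} ℓ {size (encodeGraph G)} n<N)
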